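{- Let $n \geq 2$, and let $T$ be an $n$-leaf binary tree. Let $l$ be the level of leaf $1$ (the leftmost leaf) in $T$. Then $|\mathrm{ParseWords}(T, \mathrm{LeftCombTree}(n))| = 2^{l-1}$.
   Context: A binary tree is a rooted ordered tree in which each vertex has either $0$ or $2$ children; its leaves are numbered $1,2,\dots$ from left to right. Let $G$ be the context-free grammar with start symbols $0,1,2$ and rules $0\to 12$, $0\to 21$, $1\to 02$, $1\to 20$, $2\to 01$, $2\to 10$. An $n$-leaf binary tree $T$ parses a word $w$ of length $n$ on $\{0,1,2\}$ if there is a labeling of the vertices of $T$ by $0,1,2$ such that the leaves, from left to right, are labeled with the letters of $w$, and at every internal vertex the label of the vertex together with the labels of its left and right children form a rule of $G$ (i.e. the three labels are pairwise distinct). If $T$ parses $w$, it also parses every word obtained from $w$ by permuting the alphabet $\{0,1,2\}$. For $n$-leaf binary trees $T_1,T_2$, $\mathrm{ParseWords}(T_1,T_2)$ denotes the set of equivalence classes (under permutations of the alphabet $\{0,1,2\}$) of words parsed by both $T_1$ and $T_2$. The level of a vertex is its distance from the root (the root is on level $0$). $\mathrm{LeftCombTree}(n)$ is the $n$-leaf binary tree in which the right child of every internal vertex is a leaf. -}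

module Defs where

open import Data.Fin using (Fin)
open import Data.Fin.Patterns using (0F; 1F; 2F)
open import Data.Fin.Permutation as Perm using (Permutation′; _⟨$⟩ʳ_; _∘ₚ_; flip; inverseˡ)
open import Data.List using (List; []; _∷_; _++_; map; length)
open import Data.List.Properties using (map-id; map-∘; map-cong)
open import Data.Nat using (ℕ; suc)
open import Data.Product using (Σ; ∃; _×_; _,_; proj₁)
open import Function using (_on_)
open import Function.Bundles using (Bijection)
open import Level using (Level; 0ℓ)
open import Relation.Binary.Bundles using (Setoid)
open import Relation.Binary.Definitions using (Reflexive; Symmetric; Transitive)
open import Relation.Binary.PropositionalEquality
  using (_≡_; refl; sym; trans; setoid)

data Tree : Set where
  leaf : Tree
  node : (l r : Tree) → Tree

private variable
  t l r : Tree

data Vertex : Tree → Set where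
  root  : Vertex t
  left  : Vertex l → Vertex (node l r)
  right : Vertex r → Vertex (node l r)

level : Vertex t → ℕ
level root      = 0
level (left v)  = suc (level v)
level (right v) = suc (level v)

leaves : (t : Tree) → List (Vertex t)
leaves leaf       = root ∷ []
leaves (node l r) = map left (leaves l) ++ map right (leaves r)

numLeaves : Tree → ℕ
numLeaves t = length (leaves t)

leftmostLeaf : (t : Tree) → Vertex t
leftmostLeaf leaf       = root
leftmostLeaf (node l r) = left (leftmostLeaf l)

-- There is no binary tree with 0 leaves; the value at 0 is arbitrary.
leftCombTree : ℕ → Tree
leftCombTree 0             = leaf
leftCombTree 1             = leaf
leftCombTree (suc (suc n)) = node (leftCombTree (suc n)) leaf

-- Children v a b: v is an internal vertex with left child a and right child b.
data Children : Vertex t → Vertex t → Vertex t → Set where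
  here  : Children {node l r} root (left root) (right root)
  left  : {v a b : Vertex l} → Children v a b →
          Children {node l r} (left v) (left a) (left b)
  right : {v a b : Vertex r} → Children v a b →
          Children {node l r} (right v) (right a) (right b)

Letter : Set
Letter = Fin 3

Word : Set
Word = List Letter

-- Rule x y z: the rule x → yz of the grammar.
data Rule : Letter → Letter → Letter → Set where
  0→12 : Rule 0F 1F 2F
  0→21 : Rule 0F 2F 1F
  1→02 : Rule 1F 0F 2F
  1→20 : Rule 1F 2F 0F
  2→01 : Rule 2F 0F 1F
  2→10 : Rule 2F 1F 0F

Labeling : Tree → Set
Labeling t = Vertex t → Letter

Respects : Labeling t → Set
Respects {t} f = {v a b : Vertex t} → Children v a b → Rule (f v) (f a) (f b)

-- The equation forces the length of w to be numLeaves t.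
_Parses_ : Tree → Word → Set
t Parses w = Σ (Labeling t) λ f → Respects f × map f (leaves t) ≡ w

permute : Permutation′ 3 → Word → Word
permute π = map (π ⟨$⟩ʳ_)

_∼_ : Word → Word → Set
w ∼ w′ = ∃ λ (π : Permutation′ 3) → permute π w ≡ w′

∼-refl : Reflexive _∼_
∼-refl {w} = Perm.id , map-id w

∼-sym : Symmetric _∼_
∼-sym {w} (π , refl) = flip π ,
  trans (sym (map-∘ w)) (trans (map-cong (λ _ → inverseˡ π) w) (map-id w))

∼-trans : Transitive _∼_
∼-trans {w} (π , refl) (ρ , refl) = π ∘ₚ ρ , map-∘ w

-- The quotient is represented as a setoid: its elements up to _≈_ are the
-- equivalence classes, and the parsing witnesses play no role in _≈_.
ParseWords : Tree → Tree → Setoid 0ℓ 0ℓ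
ParseWords t₁ t₂ = record
  { Carrier       = Σ Word λ w → t₁ Parses w × t₂ Parses w
  ; _≈_           = _∼_ on proj₁
  ; isEquivalence = record { refl = ∼-refl ; sym = ∼-sym ; trans = ∼-trans }
  }

HasCardinality : {c ℓ : Level} → Setoid c ℓ → ℕ → Set _
HasCardinality S k = Bijection S (setoid (Fin k))

{-# OPTIONS --safe #-}
-- Identify the letters with the nonzero elements of the Klein four-group: a
-- rule x → yz says x = y + z, so the label of a vertex is the sum of the leaves
-- below it, and the left comb parses w iff all prefix sums of w are nonzero.
-- Given a prefix sum p ≠ 0, a subtree whose root has label c ≠ p can be
-- labeled in exactly one way that keeps the subsequent prefix sums nonzero: one
-- child must have label p, and it cannot be the left one, as p + p = 0; the
-- two subtrees are then in the same situation. Hence a common word of T and the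
-- left comb is determined by its first letter and the labels of the right
-- subtrees hanging off the path to leaf 1, each of which is any letter other
-- than the label of its sibling.
-- Renaming letters fixes leaf 1 and its sibling, leaving l − 1 binary choices.
module Submission where

open import Data.Bool using (if_then_else_)
open import Data.Fin using (Fin; _≟_; combine; remQuot)
open import Data.Fin.Patterns using (0F; 1F; 2F)
open import Data.Fin.Permutation as Perm
  using (Permutation′; _⟨$⟩ʳ_; _∘ₚ_; transpose)
open import Data.Fin.Properties using (all?; remQuot-combine; combine-remQuot)
open import Data.List using (List; []; _∷_; _++_; map; length)
open import Data.List.Properties
  using (map-∘; map-cong; map-++; ++-assoc; ++-identityʳ; ∷-injective; length-map)
open import Data.List.Relation.Unary.All using (All; []; _∷_)
import Data.List.Relation.Unary.All.Properties as All
open import Data.Nat using (ℕ; zero; suc; _+_; _≤_; s≤s; _∸_; _^_)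
open import Data.Nat.Properties using (+-suc; +-identityʳ)
open import Data.Product using (∃; _×_; _,_; proj₁; proj₂)
open import Function using (_∘_; mk⇔)
open import Function.Bundles using (Injection)
open import Function.Properties.Inverse using (Inverse⇒Injection)
open import Relation.Binary.PropositionalEquality
  using (_≡_; _≢_; _≗_; refl; sym; trans; cong; cong₂; subst; subst₂; module ≡-Reasoning)
open import Relation.Nullary using (yes; no; does; ¬?; contradiction)
open import Relation.Nullary.Decidable using (_→-dec_; from-yes; does-⇔)
open import Defs

private variable
  l r t : Tree
  m p q x y z c : Letter
  u w : Word

-- Arithmetic of the grammar rules.

third : Letter → Letter → Letter
third 0F 1F = 2F
third 0F 2F = 1F
third 1F 0F = 2F
third 1F 2F = 0F
third 2F 0F = 1F
third 2F 1F = 0F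
-- Equal letters have sum zero, which is not a letter; the value here is arbitrary.
third y  _  = y

third-rule : y ≢ z → Rule (third y z) y z
third-rule {0F} {0F} y≢z = contradiction refl y≢z
third-rule {0F} {1F} _   = 2→01
third-rule {0F} {2F} _   = 1→02
third-rule {1F} {0F} _   = 2→10
third-rule {1F} {1F} y≢z = contradiction refl y≢z
third-rule {1F} {2F} _   = 0→12
third-rule {2F} {0F} _   = 1→20
third-rule {2F} {1F} _   = 0→21
third-rule {2F} {2F} y≢z = contradiction refl y≢z

third-unique : ∀ x y z → x ≢ y → x ≢ z → y ≢ z → x ≡ third y z
third-unique = from-yes (all? λ x → all? λ y → all? λ z →
  ¬? (x ≟ y) →-dec ¬? (x ≟ z) →-dec ¬? (y ≟ z) →-dec (x ≟ third y z))

-- In the Klein group x = y + z means x + y + z = 0, which is symmetric in all three letters;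
-- `rotate` and `swap` generate these symmetries.
rotate : Rule x y z → Rule y z x
rotate 0→12 = 1→20
rotate 0→21 = 2→10
rotate 1→02 = 0→21
rotate 1→20 = 2→01
rotate 2→01 = 0→12
rotate 2→10 = 1→02

swap : Rule x y z → Rule x z y
swap 0→12 = 0→21
swap 0→21 = 0→12
swap 1→02 = 1→20
swap 1→20 = 1→02
swap 2→01 = 2→10
swap 2→10 = 2→01

children-distinct : Rule x y z → y ≢ z
children-distinct 0→12 ()
children-distinct 0→21 ()
children-distinct 1→02 ()
children-distinct 1→20 ()
children-distinct 2→01 ()
children-distinct 2→10 ()

rule-third : Rule x y z → x ≡ third y z
rule-third 0→12 = refl
rule-third 0→21 = refl
rule-third 1→02 = refl
rule-third 1→20 = refl
rule-third 2→01 = refl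
rule-third 2→10 = refl

parent-left-distinct : Rule x y z → x ≢ y
parent-left-distinct ρ = children-distinct (rotate (rotate ρ))

parent-right-distinct : Rule x y z → x ≢ z
parent-right-distinct ρ = parent-left-distinct (swap ρ)

rule-parent-unique : Rule x y z → Rule c y z → x ≡ c
rule-parent-unique ρ ρ′ = trans (rule-third ρ) (sym (rule-third ρ′))

completes-rule : Rule x y z → c ≢ y → c ≢ z → c ≡ x
completes-rule ρ c≢y c≢z =
  trans (third-unique _ _ _ c≢y c≢z (children-distinct ρ)) (sym (rule-third ρ))

-- Renaming letters.

module _ (π : Permutation′ 3) where

  permutation-injective : π ⟨$⟩ʳ x ≡ π ⟨$⟩ʳ y → x ≡ y
  permutation-injective = Injection.injective (Inverse⇒Injection π)

  permute-rule : Rule x y z → Rule (π ⟨$⟩ʳ x) (π ⟨$⟩ʳ y) (π ⟨$⟩ʳ z)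
  permute-rule ρ = subst (λ x → Rule x _ _)
    (sym (third-unique _ _ _
      (parent-left-distinct ρ ∘ permutation-injective)
      (parent-right-distinct ρ ∘ permutation-injective)
      y≢z))
    (third-rule y≢z)
    where y≢z = children-distinct ρ ∘ permutation-injective

  permute-respects : (f : Labeling t) → Respects f → Respects ((π ⟨$⟩ʳ_) ∘ f)
  permute-respects f f-resp = λ κ → permute-rule (f-resp κ)

-- Supplies the renaming that brings the labels of leaf 1 and its sibling to the fixed values used
-- by `decode`.
normalize-pair : y ≢ z → ∃ λ (π : Permutation′ 3) → π ⟨$⟩ʳ y ≡ 0F × π ⟨$⟩ʳ z ≡ 1F
normalize-pair {0F} {0F} y≢z = contradiction refl y≢z
normalize-pair {0F} {1F} _   = Perm.id , refl , refl
normalize-pair {0F} {2F} _   = transpose 1F 2F , refl , refl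
normalize-pair {1F} {0F} _   = transpose 0F 1F , refl , refl
normalize-pair {1F} {1F} y≢z = contradiction refl y≢z
normalize-pair {1F} {2F} _   = transpose 0F 1F ∘ₚ transpose 1F 2F , refl , refl
normalize-pair {2F} {0F} _   = transpose 0F 2F ∘ₚ transpose 1F 2F , refl , refl
normalize-pair {2F} {1F} _   = transpose 0F 2F , refl , refl
normalize-pair {2F} {2F} y≢z = contradiction refl y≢z

-- Runs through nonzero prefix sums.

-- Run p w q: a left comb whose root is labeled p, extended by further right
-- leaves labeled w, gets the root label q.
data Run : Letter → Word → Letter → Set where
  []  : Run p [] p
  _∷_ : Rule m p c → Run m w q → Run p (c ∷ w) q

run-++ : Run p u m → Run m w q → Run p (u ++ w) q
run-++ []      s = s
run-++ (ρ ∷ r) s = ρ ∷ run-++ r s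

run-split : ∀ u → Run p (u ++ w) q → ∃ λ m → Run p u m × Run m w q
run-split []      s = _ , [] , s
run-split (_ ∷ u) (ρ ∷ s) with m , s₁ , s₂ ← run-split u s = m , ρ ∷ s₁ , s₂

permute-run : (π : Permutation′ 3) → Run p w q →
  Run (π ⟨$⟩ʳ p) (permute π w) (π ⟨$⟩ʳ q)
permute-run π []      = []
permute-run π (ρ ∷ s) = permute-rule π ρ ∷ permute-run π s

permute-map-run : {A : Set} (π : Permutation′ 3) (f : A → Letter) (xs : List A) →
  Run p (map f xs) q → Run (π ⟨$⟩ʳ p) (map ((π ⟨$⟩ʳ_) ∘ f) xs) (π ⟨$⟩ʳ q)
permute-map-run π f xs s = subst (λ w → Run _ w _) (sym (map-∘ xs)) (permute-run π s)

-- The empty prefix has sum zero, which is no letter, so a run over the whole tree has to start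
-- after leaf 1, in the state given by the letter of that leaf.
otherLeaves : (t : Tree) → List (Vertex t)
otherLeaves leaf       = []
otherLeaves (node l r) = map left (otherLeaves l) ++ map right (leaves r)

leaves-∷ : (t : Tree) → leaves t ≡ leftmostLeaf t ∷ otherLeaves t
leaves-∷ leaf       = refl
leaves-∷ (node l r) = cong (λ vs → map left vs ++ map right (leaves r)) (leaves-∷ l)

map-children : (f : Labeling (node l r)) (us : List (Vertex l)) (vs : List (Vertex r)) →
  map f (map left us ++ map right vs) ≡ map (f ∘ left) us ++ map (f ∘ right) vs
map-children f us vs = trans (map-++ f (map left us) (map right vs))
  (cong₂ _++_ (sym (map-∘ us)) (sym (map-∘ vs)))

run-children-split : (f : Labeling (node l r)) (us : List (Vertex l)) (vs : List (Vertex r)) →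
  Run p (map f (map left us ++ map right vs)) q →
  ∃ λ m → Run p (map (f ∘ left) us) m × Run m (map (f ∘ right) vs) q
run-children-split f us vs s =
  run-split (map (f ∘ left) us) (subst (λ w → Run _ w _) (map-children f us vs) s)

run-children-++ : (f : Labeling (node l r)) (us : List (Vertex l)) (vs : List (Vertex r)) →
  Run p (map (f ∘ left) us) m → Run m (map (f ∘ right) vs) q →
  Run p (map f (map left us ++ map right vs)) q
run-children-++ f us vs s₁ s₂ =
  subst (λ w → Run _ w _) (sym (map-children f us vs)) (run-++ s₁ s₂)

-- Labelings are determined by their leaf words.

map-agree : {A : Set} (f g : A → Letter) (xs : List A) →
  map f xs ≡ map g xs → All (λ x → f x ≡ g x) xs
map-agree f g []       _  = []
map-agree f g (x ∷ xs) eq with fx≡gx , eq′ ← ∷-injective eq = fx≡gx ∷ map-agree f g xs eq′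

-- In a rule the children determine the parent, so agreement propagates from the leaves upwards.
labeling-unique : (t : Tree) (f g : Labeling t) → Respects f → Respects g →
  All (λ v → f v ≡ g v) (leaves t) → f ≗ g
labeling-unique leaf f g _ _ (eq ∷ []) root = eq
labeling-unique (node l r) f g f-resp g-resp eqs = agree
  where
  agreeˡ : f ∘ left ≗ g ∘ left
  agreeˡ = labeling-unique l (f ∘ left) (g ∘ left) (f-resp ∘ left) (g-resp ∘ left)
    (All.map⁻ (All.++⁻ˡ (map left (leaves l)) eqs))

  agreeʳ : f ∘ right ≗ g ∘ right
  agreeʳ = labeling-unique r (f ∘ right) (g ∘ right) (f-resp ∘ right) (g-resp ∘ right)
    (All.map⁻ (All.++⁻ʳ (map left (leaves l)) eqs))

  agree : f ≗ g
  agree root      = rule-parent-unique (f-resp here)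
    (subst₂ (Rule (g root)) (sym (agreeˡ root)) (sym (agreeʳ root)) (g-resp here))
  agree (left v)  = agreeˡ v
  agree (right v) = agreeʳ v

-- Forced labelings of right subtrees, and steps up the path to leaf 1.

-- The only labeling of a tree with root label c whose leaf word can be read
-- from the state p ≢ c.
labelingFrom : (p c : Letter) → Labeling t
labelingFrom p c root      = c
labelingFrom p c (left v)  = labelingFrom p (third p c) v
labelingFrom p c (right v) = labelingFrom c p v

labelingFrom-respects : (t : Tree) → p ≢ c → Respects {t} (labelingFrom p c)
labelingFrom-respects (node l r) p≢c here =
  rotate (rotate (third-rule p≢c))
labelingFrom-respects (node l r) p≢c (left κ) =
  labelingFrom-respects l (parent-left-distinct (third-rule p≢c) ∘ sym) κ
labelingFrom-respects (node l r) p≢c (right κ) =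
  labelingFrom-respects r (p≢c ∘ sym) κ

-- At a node, the left subtree has label `third p c`, which is q, and moves the state from p to p +
-- q = c; the right subtree has label p and moves it from c to c + p = q.
labelingFrom-run : (t : Tree) → Rule q p c → Run p (map (labelingFrom p c) (leaves t)) q
labelingFrom-run leaf ρ = ρ ∷ []
labelingFrom-run {q} {p} {c} (node l r) ρ =
  run-children-++ {l} {r} (labelingFrom p c) (leaves l) (leaves r)
    (labelingFrom-run l
      (subst (Rule c p) (rule-third ρ) (swap (rotate (rotate ρ)))))
    (labelingFrom-run r (swap ρ))

labelingFrom-unique : (t : Tree) (f : Labeling t) → Respects f →
  Run p (map f (leaves t)) q → Rule q p (f root) × f ≗ labelingFrom p (f root)
labelingFrom-unique leaf f _ (ρ ∷ []) = ρ , λ { root → refl }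
labelingFrom-unique {p} {q} (node l r) f f-resp s
  with m , s₁ , s₂ ← run-children-split f (leaves l) (leaves r) s
  with ρ₁ , eq₁ ← labelingFrom-unique l (f ∘ left) (f-resp ∘ left) s₁
  with ρ₂ , eq₂ ← labelingFrom-unique r (f ∘ right) (f-resp ∘ right) s₂
  = subst (Rule q p) m≡root (swap (subst (Rule q m) z≡p ρ₂)) , agree
  where
  -- The right label differs from its sibling and, by `ρ₂`, from the state m. By `ρ₁` the letter
  -- distinct from these two is p.
  z≡p : f (right root) ≡ p
  z≡p = completes-rule (rotate ρ₁)
    (children-distinct (f-resp here) ∘ sym) (children-distinct ρ₂ ∘ sym)

  m≡root : m ≡ f root
  m≡root = rule-parent-unique (swap ρ₁) (subst (Rule _ _) z≡p (f-resp here))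

  y≡third : f (left root) ≡ third p (f root)
  y≡third = rule-third (subst (Rule _ p) m≡root (swap (rotate (rotate ρ₁))))

  agree : f ≗ labelingFrom p (f root)
  agree root      = refl
  agree (left v)  = trans (eq₁ v) (cong (λ y → labelingFrom p y v) y≡third)
  agree (right v) = trans (eq₂ v) (cong₂ (λ p c → labelingFrom p c v) m≡root z≡p)

-- The final state and the root label are both the sum of all leaf letters. In particular, a right
-- subtree hanging off the path to leaf 1 is entered in the state that labels its left sibling.
run-ends-at-root : (t : Tree) (f : Labeling t) → Respects f →
  Run (f (leftmostLeaf t)) (map f (otherLeaves t)) q → q ≡ f root
run-ends-at-root leaf f _ [] = refl
run-ends-at-root (node l r) f f-resp s
  with m , s₁ , s₂ ← run-children-split f (otherLeaves l) (leaves r) s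
  with refl ← run-ends-at-root l (f ∘ left) (f-resp ∘ left) s₁
  = rule-parent-unique
      (proj₁ (labelingFrom-unique r (f ∘ right) (f-resp ∘ right) s₂)) (f-resp here)

-- One step up the path to leaf 1. The right subtree is read from the state `g root`, so its root
-- label z is the only freedom.
extend : Labeling l → Letter → Labeling (node l r)
extend g z root      = third (g root) z
extend g z (left v)  = g v
extend g z (right v) = labelingFrom (g root) z v

extend-respects : (g : Labeling l) → Respects g → g root ≢ z → Respects {node l r} (extend g z)
extend-respects g g-resp y≢z here      = third-rule y≢z
extend-respects g g-resp y≢z (left κ)  = g-resp κ
extend-respects g g-resp y≢z (right κ) = labelingFrom-respects _ y≢z κ

extend-run : (l r : Tree) (g : Labeling l) →
  Run (g (leftmostLeaf l)) (map g (otherLeaves l)) (g root) → g root ≢ z →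
  Run (g (leftmostLeaf l)) (map (extend {l} {r} g z) (otherLeaves (node l r))) (third (g root) z)
extend-run l r g s y≢z = run-children-++ {l} {r} (extend g _) (otherLeaves l) (leaves r)
  s (labelingFrom-run r (third-rule y≢z))

extend-unique : (f : Labeling (node l r)) → Respects f →
  Run (f (leftmostLeaf (node l r))) (map f (otherLeaves (node l r))) q →
  (g : Labeling l) → f ∘ left ≗ g → f (right root) ≡ z → f ≗ extend g z
extend-unique {l} {r} {z = z} f f-resp s g f≗g fz
  with m , s₁ , s₂ ← run-children-split f (otherLeaves l) (leaves r) s
  with refl ← run-ends-at-root l (f ∘ left) (f-resp ∘ left) s₁
  = agree
  where
  agree : f ≗ extend g z
  agree root      = trans (rule-third (f-resp here)) (cong₂ third (f≗g root) fz)
  agree (left v)  = f≗g v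
  agree (right v) = trans (proj₂ (labelingFrom-unique r (f ∘ right) (f-resp ∘ right) s₂) v)
    (cong₂ (λ p c → labelingFrom p c v) (f≗g root) fz)

-- Binary choices along the path, coding and decoding.

turn : Letter → Letter → Fin 2
turn z y = if does (z ≟ y) then 0F else 1F

pick : Fin 2 → Letter → Letter → Letter
pick 0F y z = y
pick 1F y z = z

pick-turn : Rule x y z → c ≢ x → pick (turn c y) y z ≡ c
pick-turn {y = y} {c = c} ρ c≢x with c ≟ y
... | yes c≡y = sym c≡y
... | no  c≢y = sym (completes-rule (rotate (rotate ρ)) c≢x c≢y)

turn-pick : ∀ b → y ≢ z → turn (pick b y z) y ≡ b
turn-pick {y} 0F _ with y ≟ y
... | yes _  = refl
... | no y≢y = contradiction refl y≢y
turn-pick {y} {z} 1F y≢z with z ≟ y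
... | yes z≡y = contradiction (sym z≡y) y≢z
... | no _    = refl

parent≢pick : ∀ b → Rule x y z → x ≢ pick b y z
parent≢pick 0F = parent-left-distinct
parent≢pick 1F = parent-right-distinct

-- On the path to leaf 1, the right sibling of a non-root internal vertex is
-- labeled as the left or as the right child of that vertex; the code records
-- these choices, which do not depend on the names of the letters.
code : (l r : Tree) → Labeling (node l r) → Fin (2 ^ level (leftmostLeaf l))
code leaf         r f = 0F
code (node l₁ r₁) r f =
  combine (turn (f (right root)) (f (left (left root)))) (code l₁ r₁ (f ∘ left))

splitCode : ∀ k → Fin (2 ^ suc k) → Fin 2 × Fin (2 ^ k)
splitCode k = remQuot {2} (2 ^ k)

extendByTurn : Fin 2 → Labeling (node l r) → Labeling (node (node l r) t)
extendByTurn b g = extend g (pick b (g (left root)) (g (right root)))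

decode : (l r : Tree) → Fin (2 ^ level (leftmostLeaf l)) → Labeling (node l r)
-- The chosen representative of a class: leaf 1 is labeled 0F and its sibling 1F, so the bottom of
-- the path contributes no bit.
decode leaf         r _ = extend (λ _ → 0F) 1F
decode (node l₁ r₁) r k = extendByTurn b (decode l₁ r₁ k′)
  where
  b = proj₁ (splitCode (level (leftmostLeaf l₁)) k)
  k′ = proj₂ (splitCode (level (leftmostLeaf l₁)) k)

-- Each bit is the outcome of an equality test between two labels, and an injective renaming
-- preserves and reflects equality.
code-permute : (π : Permutation′ 3) (l r : Tree) (f g : Labeling (node l r)) →
  (π ⟨$⟩ʳ_) ∘ f ≗ g → code l r f ≡ code l r g
code-permute π leaf         r f g eq = refl
code-permute π (node l₁ r₁) r f g eq = cong₂ combine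
  (cong (if_then 0F else 1F) (does-⇔
    (mk⇔ (λ e → trans (sym (eq _)) (trans (cong (π ⟨$⟩ʳ_) e) (eq _)))
         (λ e → permutation-injective π (trans (eq _) (trans e (sym (eq _))))))
    (f (right root) ≟ f (left (left root))) (g (right root) ≟ g (left (left root)))))
  (code-permute π l₁ r₁ (f ∘ left) (g ∘ left) (eq ∘ left))

decode-respects : ∀ l r k → Respects (decode l r k)
decode-respects leaf         r k = extend-respects (λ _ → 0F) (λ ()) (λ ())
decode-respects (node l₁ r₁) r k =
  extend-respects _ g-resp (parent≢pick b (g-resp here))
  where
  b = proj₁ (splitCode (level (leftmostLeaf l₁)) k)
  g-resp = decode-respects l₁ r₁ (proj₂ (splitCode (level (leftmostLeaf l₁)) k))

decode-run : ∀ l r k → Run (decode l r k (leftmostLeaf (node l r)))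
  (map (decode l r k) (otherLeaves (node l r))) (decode l r k root)
decode-run leaf         r k = extend-run leaf r (λ _ → 0F) [] (λ ())
decode-run (node l₁ r₁) r k = extend-run (node l₁ r₁) r (decode l₁ r₁ k′)
  (decode-run l₁ r₁ k′) (parent≢pick b (decode-respects l₁ r₁ k′ here))
  where
  b = proj₁ (splitCode (level (leftmostLeaf l₁)) k)
  k′ = proj₂ (splitCode (level (leftmostLeaf l₁)) k)

code-decode : ∀ l r k → code l r (decode l r k) ≡ k
code-decode leaf         r 0F = refl
code-decode (node l₁ r₁) r k = trans
  (cong₂ combine (turn-pick b (children-distinct (decode-respects l₁ r₁ k′ here)))
    (code-decode l₁ r₁ k′))
  (combine-remQuot {2} (2 ^ level (leftmostLeaf l₁)) k)
  where
  b = proj₁ (splitCode (level (leftmostLeaf l₁)) k)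
  k′ = proj₂ (splitCode (level (leftmostLeaf l₁)) k)

pick-natural : (h : Letter → Letter) → ∀ b → h (pick b y z) ≡ pick b (h y) (h z)
pick-natural h 0F = refl
pick-natural h 1F = refl

-- The renaming is chosen once, at the bottom of the path, and serves all levels above: each sibling
-- label is recovered from its bit by `pick`, which commutes with renaming, and `extend-unique`
-- forces the rest.
decode-code : (l r : Tree) (f : Labeling (node l r)) → Respects f →
  Run (f (leftmostLeaf (node l r))) (map f (otherLeaves (node l r))) q →
  ∃ λ (π : Permutation′ 3) → (π ⟨$⟩ʳ_) ∘ f ≗ decode l r (code l r f)
decode-code leaf r f f-resp s
  with π , πy≡0 , πz≡1 ← normalize-pair (children-distinct (f-resp here))
  = π , extend-unique {leaf} {r} ((π ⟨$⟩ʳ_) ∘ f) (permute-respects π f f-resp)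
          (permute-map-run π f (otherLeaves (node leaf r)) s)
          (λ _ → 0F) (λ { root → πy≡0 }) πz≡1
decode-code (node l₁ r₁) r f f-resp s
  with _ , s₁ , _ ← run-children-split f (otherLeaves (node l₁ r₁)) (leaves r) s
  with π , eq ← decode-code l₁ r₁ (f ∘ left) (f-resp ∘ left) s₁
  -- `decode` splits a code that `code` has just combined; the transport along `remQuot-combine`
  -- cancels the two.
  = π , subst (λ (b , k) → (π ⟨$⟩ʳ_) ∘ f ≗ extendByTurn b (decode l₁ r₁ k))
          (sym (remQuot-combine b (code l₁ r₁ (f ∘ left))))
          (extend-unique ((π ⟨$⟩ʳ_) ∘ f) (permute-respects π f f-resp)
            (permute-map-run π f (otherLeaves (node (node l₁ r₁) r)) s)
            (decode l₁ r₁ (code l₁ r₁ (f ∘ left))) eq sibling)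
  where
  b = turn (f (right root)) (f (left (left root)))
  g = decode l₁ r₁ (code l₁ r₁ (f ∘ left))
  open ≡-Reasoning
  sibling : π ⟨$⟩ʳ f (right root) ≡ pick b (g (left root)) (g (right root))
  sibling = begin
    π ⟨$⟩ʳ f (right root)
      ≡⟨ cong (π ⟨$⟩ʳ_) (pick-turn (f-resp (left here)) (children-distinct (f-resp here) ∘ sym)) ⟨
    π ⟨$⟩ʳ pick b (f (left (left root))) (f (left (right root)))
      ≡⟨ pick-natural (π ⟨$⟩ʳ_) b ⟩
    pick b (π ⟨$⟩ʳ f (left (left root))) (π ⟨$⟩ʳ f (left (right root)))
      ≡⟨ cong₂ (pick b) (eq (left root)) (eq (right root)) ⟩
    pick b (g (left root)) (g (right root)) ∎

-- Words parsed by the left comb as runs.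

leftComb-run : ∀ n (f : Labeling (leftCombTree (suc n))) → Respects f →
  Run (f (leftmostLeaf (leftCombTree (suc n))))
      (map f (otherLeaves (leftCombTree (suc n)))) (f root)
leftComb-run zero    f _      = []
leftComb-run (suc n) f f-resp =
  run-children-++ f (otherLeaves (leftCombTree (suc n))) (leaves leaf)
    (leftComb-run n (f ∘ left) (f-resp ∘ left)) (f-resp here ∷ [])

-- The comb grows at its root as letters are read, so the induction carries the comb labeled so far
-- as an accumulator; its root label is the current state.
leftComb-parses : ∀ n (f : Labeling (leftCombTree (suc n))) → Respects f → Run (f root) w q →
  leftCombTree (suc (length w + n)) Parses (map f (leaves (leftCombTree (suc n))) ++ w)
leftComb-parses n f f-resp [] = f , f-resp , sym (++-identityʳ _)
leftComb-parses {c ∷ w} n f f-resp (ρ ∷ s) = subst₂ (λ k → leftCombTree (suc k) Parses_)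
  (+-suc (length w) n)
  (trans (cong (_++ w) (map-children f′ (leaves comb) (leaves leaf))) (++-assoc _ (c ∷ []) w))
  (leftComb-parses (suc n) f′ (extend-respects f f-resp p≢c)
    (subst (λ x → Run x w _) (rule-third ρ) s))
  where
  comb = leftCombTree (suc n)
  p≢c = children-distinct ρ
  f′ : Labeling (node comb leaf)
  f′ = extend f c

leftComb-parses⇒run : (t : Tree) (f : Labeling t) →
  leftCombTree (numLeaves t) Parses map f (leaves t) →
  ∃ λ q → Run (f (leftmostLeaf t)) (map f (otherLeaves t)) q
-- The rewriting splits off leaf 1 and makes the number of leaves a visible successor, so that
-- `leftComb-run` applies.
leftComb-parses⇒run t f rewrite leaves-∷ t = λ where
  (g , g-resp , eq) →
    let comb    = leftCombTree (suc (length (otherLeaves t)))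
        e₁ , e₂ = ∷-injective (trans (sym (cong (map g) (leaves-∷ comb))) eq)
    in g root , subst₂ (λ p w → Run p w (g root)) e₁ e₂ (leftComb-run _ g g-resp)

run⇒leftComb-parses : (t : Tree) (f : Labeling t) →
  Run (f (leftmostLeaf t)) (map f (otherLeaves t)) q →
  leftCombTree (numLeaves t) Parses map f (leaves t)
run⇒leftComb-parses t f s rewrite leaves-∷ t = subst
  (λ k → leftCombTree (suc k) Parses (map f (leftmostLeaf t ∷ otherLeaves t)))
  (trans (+-identityʳ _) (length-map f (otherLeaves t)))
  -- The accumulator starts as the one-leaf comb carrying the letter of leaf 1.
  (leftComb-parses 0 (λ _ → f (leftmostLeaf t)) (λ ()) s)

-- The bijection between classes of words and codes.

theorem12 : (n : ℕ) → 2 ≤ n → (T : Tree) → numLeaves T ≡ n →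
    HasCardinality (ParseWords T (leftCombTree n)) (2 ^ (level (leftmostLeaf T) ∸ 1))
theorem12 _ 2≤n leaf refl = contradiction 2≤n λ { (s≤s ()) }
-- For a node the exponent reduces to `level (leftmostLeaf l)`, the number of bits in a code.
theorem12 _ _ T@(node l r) refl = record
  { to        = toCode
  ; cong      = λ {x} {y} → toCode-cong x y
  ; bijective = (λ {x} {y} → toCode-injective x y) , λ k → fromCode k ,
      λ {x} x∼k → trans (toCode-cong x (fromCode k) x∼k) (code-decode l r k)
  }
  where
  Class : Set
  Class = ∃ λ w → T Parses w × leftCombTree (numLeaves T) Parses w

  toCode : Class → Fin (2 ^ level (leftmostLeaf l))
  toCode (_ , (f , _) , _) = code l r f

  toCode-cong : (x y : Class) → proj₁ x ∼ proj₁ y → toCode x ≡ toCode y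
  toCode-cong (_ , (f , f-resp , refl) , _) (_ , (g , g-resp , refl) , _) (π , eq) =
    -- Equivalence only relates the two words; `labeling-unique` lifts the renaming to the full
    -- labelings, on which `code` is defined.
    code-permute π l r f g
      (labeling-unique T _ g (permute-respects π f f-resp) g-resp
        (map-agree _ g (leaves T) (trans (map-∘ (leaves T)) eq)))

  fromCode : Fin (2 ^ level (leftmostLeaf l)) → Class
  fromCode k = map f (leaves T) , (f , decode-respects l r k , refl) ,
    run⇒leftComb-parses T f (decode-run l r k)
    where f = decode l r k

  ∼-decode : (x : Class) → proj₁ x ∼ map (decode l r (toCode x)) (leaves T)
  ∼-decode (_ , (f , f-resp , refl) , comb)
    with _ , s ← leftComb-parses⇒run T f comb
    with π , eq ← decode-code l r f f-resp s
    = π , trans (sym (map-∘ (leaves T))) (map-cong eq (leaves T))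

  toCode-injective : (x y : Class) → toCode x ≡ toCode y → proj₁ x ∼ proj₁ y
  toCode-injective x y eq = ∼-trans
    (subst (λ k → proj₁ x ∼ map (decode l r k) (leaves T)) eq (∼-decode x))
    (∼-sym (∼-decode y))
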